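{- Let $k$ be a positive integer. Then for all sufficiently large $n$ the following holds: for every integer $N$ with $0\le N\le n^{k-1}$, any $N$ $k$-rooks placed at distinct points of $H_{n,k}$ cover at most \[ kNn-\frac{(k-1)N^2}{n^{k-2}} \] points of $H_{n,k}$.
   Context: Let $H_{n,k}=\{0,1,\dots,n-1\}^k$. A $k$-rook in $H_{n,k}$ is a point $P\in H_{n,k}$ which covers $P$ itself and every point of $H_{n,k}$ differing from $P$ in exactly one coordinate (i.e., all points at Hamming distance at most $1$ from $P$). -}

module Defs where

open import Data.Nat using (ℕ; zero; suc; _+_; _≤?_)
open import Data.Fin using (Fin)
open import Data.Fin.Properties using (_≟_)
open import Data.Vec using (Vec; []; _∷_)
open import Data.List using (List; []; _∷_; map; concatMap; length; filter)
open import Data.List.Relation.Unary.Any using (any?)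
open import Data.Fin.Base using () renaming (zero to fz)
open import Relation.Nullary using (yes; no)

Point : ℕ → ℕ → Set
Point n k = Vec (Fin n) k

allFinList : (n : ℕ) → List (Fin n)
allFinList zero = []
allFinList (suc n) = Fin.zero ∷ map Fin.suc (allFinList n)
  where import Data.Fin as Fin

allPoints : (n k : ℕ) → List (Point n k)
allPoints n zero = [] ∷ []
allPoints n (suc k) = concatMap (λ i → map (i ∷_) (allPoints n k)) (allFinList n)

hamming : ∀ {n k} → Point n k → Point n k → ℕ
hamming [] [] = 0
hamming (x ∷ xs) (y ∷ ys) with x ≟ y
... | yes _ = hamming xs ys
... | no _ = suc (hamming xs ys)

coveredCount : ∀ {n k} → List (Point n k) → ℕ
coveredCount {n} {k} rooks =
  length (filter (λ p → any? (λ r → hamming r p ≤? 1) rooks) (allPoints n k))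

{-# OPTIONS --safe #-}
module Submission where

-- For a point p let e(p) be the number of directions i whose line through p
-- contains a rook, eᵢ(p) ∈ {0, 1} the contribution of direction i. Since
-- (e − 1)(e − k) ≤ 0 whenever 1 ≤ e ≤ k, summing over p gives
--   k · covered + Σᵢⱼ Σₚ eᵢ eⱼ ≤ (k + 1) Σᵢ Σₚ eᵢ,
-- so it suffices to bound the crossings Σₚ eᵢ eⱼ (i ≠ j) from below. In a plane in
-- directions i, j holding s rooks that meet a of its i-lines and b of its j-lines,
-- the crossings number a b, and with c = k − 1 and y the average number of rooks
-- per plane,
--   k n (a + b) + 4 c y s ≤ 2 k n s + 2 c a b + 2 c y²   whenever c y ≤ n.
-- At a = b = s this is 2 c (s − y)² ≥ 0, and it is affine in each of s, a, b.
-- Summing over all planes and all pairs i ≠ j yields the bound when c N ≤ n^c.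
-- When c N ≥ n^c, the bound is at least the trivial n^k. Every n ≥ 1 works.

open import Defs
open import Data.Nat using (ℕ; _+_; _*_; _∸_; _^_; _≤_)
open import Data.Product using (∃-syntax)
open import Data.List using (List; length)
open import Data.List.Relation.Unary.Unique.Propositional using (Unique)
open import Relation.Binary.PropositionalEquality using (_≡_)

open import Data.Bool using (true; false; if_then_else_)
open import Data.Fin using (Fin; zero; suc; punchIn)
open import Data.Fin.Properties using (_≟_; punchInᵢ≢i)
open import Data.List using ([]; _∷_; _++_; map; concatMap; filter)
open import Data.List.Properties using (map-∘; map-++)
open import Data.List.Relation.Unary.Any using (Any; any?; here; there)
open import Data.Nat using (zero; suc; _⊓_; z≤n; s≤s; _≤?_; NonZero; >-nonZero)
import Data.Nat.ListAction as List
open import Data.Nat.ListAction.Properties using (sum-++)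
open import Data.Nat.Properties hiding (_≟_)
open import Algebra.Properties.Semiring.Sum +-*-semiring
open import Data.Nat.Tactic.RingSolver using (solve-∀)
open import Data.Product using (_,_)
open import Data.Sum using (inj₁; inj₂)
open import Data.Vec using ([]; _∷_; _[_]≔_)
open import Data.Vec.Functional using (removeAt)
open import Data.Vec.Properties using ([]≔-commutes; []≔-idempotent)
open import Function using (_∘_)
open import Relation.Binary.PropositionalEquality using (_≢_; refl; sym; trans; cong; cong₂; subst; module ≡-Reasoning)
open import Relation.Nullary using (Dec; yes; no; does; contradiction)

-- Quadratic inequalities, ending with the inequality for a single plane.

-- This is (v - x)(v - c x) ≤ 0 with the subtractions cleared. It serves twice: with `x = 1` for the
-- number of occupied directions at a covered point, and with `x = N`, `v = n ^ c` for dense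
-- placements.
square-below-chord : ∀ c x v → x ≤ v → v ≤ c * x → v * v + c * (x * x) ≤ suc c * (x * v)
square-below-chord c x v x≤v v≤cx with m≤n⇒∃[o]m+o≡n x≤v
... | t , refl = begin
  (x + t) * (x + t) + c * (x * x)                ≡⟨ lhs c x t ⟩
  t * (x + t) + (x * (x + t) + c * (x * x))      ≤⟨ +-monoˡ-≤ _ (*-monoʳ-≤ t v≤cx) ⟩
  t * (c * x) + (x * (x + t) + c * (x * x))      ≡⟨ rhs c x t ⟩
  suc c * (x * (x + t))                          ∎
  where
  open ≤-Reasoning
  lhs : ∀ c x t → (x + t) * (x + t) + c * (x * x) ≡ t * (x + t) + (x * (x + t) + c * (x * x))
  lhs = solve-∀
  rhs : ∀ c x t → t * (c * x) + (x * (x + t) + c * (x * x)) ≡ suc c * (x * (x + t))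
  rhs = solve-∀

2xy≤x²+y² : ∀ x y → 2 * (x * y) ≤ x * x + y * y
2xy≤x²+y² x y with ≤-total x y
... | inj₁ x≤y with m≤n⇒∃[o]m+o≡n x≤y
...   | t , refl = m+n≤o⇒m≤o _ {t * t} (≤-reflexive (eq x t))
  where
  eq : ∀ x t → 2 * (x * (x + t)) + t * t ≡ x * x + (x + t) * (x + t)
  eq = solve-∀
2xy≤x²+y² x y | inj₂ y≤x with m≤n⇒∃[o]m+o≡n y≤x
...   | t , refl = m+n≤o⇒m≤o _ {t * t} (≤-reflexive (eq y t))
  where
  eq : ∀ y t → 2 * ((y + t) * y) + t * t ≡ (y + t) * (y + t) + y * y
  eq = solve-∀

-- The plane inequality is affine in s, in a and in b, so it can be checked at
-- s = a ≥ b, then at b = a (a square) and b = 0, and in the latter case at a = m.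
-- There, with m = c y + f, the slack is c (c-1) (c-2) y² + 2 c (c-1) y f + (c+1) f².
plane-b≡0-a≡m : ∀ c m y → c * y ≤ m → 4 * c * y * m ≤ suc c * m * m + 2 * c * (y * y)
plane-b≡0-a≡m c m y cy≤m with m≤n⇒∃[o]m+o≡n cy≤m
plane-b≡0-a≡m zero m y _ | f , refl = z≤n
plane-b≡0-a≡m (suc zero) _ y _ | f , refl = m+n≤o⇒m≤o _ {2 * (f * f)} (≤-reflexive (eq y f))
  where
  eq : ∀ y f → 4 * 1 * y * (1 * y + f) + 2 * (f * f)
             ≡ 2 * (1 * y + f) * (1 * y + f) + 2 * 1 * (y * y)
  eq = solve-∀
plane-b≡0-a≡m (suc (suc g)) _ y _ | f , refl = m+n≤o⇒m≤o _ (≤-reflexive (eq g y f))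
  where
  eq : ∀ g y f → 4 * (2 + g) * y * ((2 + g) * y + f)
                 + (y * y * ((2 + g) * (1 + g) * g) + 2 * ((2 + g) * (1 + g)) * (y * f) + (3 + g) * (f * f))
               ≡ (3 + g) * ((2 + g) * y + f) * ((2 + g) * y + f) + 2 * (2 + g) * (y * y)
  eq = solve-∀

-- Right side minus left side is affine in `a` with slope `suc c * m` - `4 * c * y`. For a
-- nonpositive slope the worst case is `a = m`, reached by adding the missing `e = m - a`; otherwise
-- the linear term on the right dominates at once.
plane-b≡0 : ∀ c m y a → c * y ≤ m → a ≤ m → 4 * c * y * a ≤ suc c * m * a + 2 * c * (y * y)
plane-b≡0 c m y a cy≤m a≤m with suc c * m ≤? 4 * c * y | m≤n⇒∃[o]m+o≡n a≤m
... | yes km≤4cy | e , a+e≡m = +-cancelʳ-≤ (4 * c * y * e) _ _ (begin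
  4 * c * y * a + 4 * c * y * e                       ≡⟨ *-distribˡ-+ (4 * c * y) a e ⟨
  4 * c * y * (a + e)                                 ≡⟨ cong (4 * c * y *_) a+e≡m ⟩
  4 * c * y * m                                       ≤⟨ plane-b≡0-a≡m c m y cy≤m ⟩
  suc c * m * m + 2 * c * (y * y)                     ≡⟨ cong (λ z → suc c * m * z + 2 * c * (y * y)) a+e≡m ⟨
  suc c * m * (a + e) + 2 * c * (y * y)               ≡⟨ eq (suc c * m) a e (2 * c * (y * y)) ⟩
  suc c * m * a + 2 * c * (y * y) + suc c * m * e     ≤⟨ +-monoʳ-≤ _ (*-monoˡ-≤ e km≤4cy) ⟩
  suc c * m * a + 2 * c * (y * y) + 4 * c * y * e     ∎)
  where
  open ≤-Reasoning
  eq : ∀ u a e z → u * (a + e) + z ≡ u * a + z + u * e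
  eq = solve-∀
... | no km≰4cy | _ = ≤-trans (*-monoˡ-≤ a (≰⇒≥ km≰4cy)) (m≤m+n _ _)

-- This is the plane inequality at s = a = `b + d`, after `suc c * m * (a + b)` has been subtracted
-- from both sides. For fixed a the right side is affine in b with slope 2 c a - (c + 1) m: if it
-- increases, b = 0 is the worst case; if it decreases, b = a is, where 2 a y ≤ a² + y² suffices.
plane-s≡a : ∀ c m y b d → c * y ≤ m → b + d ≤ m →
       4 * c * y * (b + d) ≤ suc c * m * d + 2 * c * ((b + d) * b) + 2 * c * (y * y)
plane-s≡a c m y b d cy≤m a≤m with suc c * m ≤? 2 * c * (b + d)
... | yes km≤2ca = begin
  4 * c * y * (b + d)                                                ≤⟨ plane-b≡0 c m y (b + d) cy≤m a≤m ⟩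
  suc c * m * (b + d) + 2 * c * (y * y)                              ≡⟨ cong (_+ 2 * c * (y * y)) (*-distribˡ-+ (suc c * m) b d) ⟩
  suc c * m * b + suc c * m * d + 2 * c * (y * y)                    ≤⟨ +-monoˡ-≤ _ (+-monoˡ-≤ _ (*-monoˡ-≤ b km≤2ca)) ⟩
  2 * c * (b + d) * b + suc c * m * d + 2 * c * (y * y)              ≡⟨ eq c (b + d) b (suc c * m * d) (2 * c * (y * y)) ⟩
  suc c * m * d + 2 * c * ((b + d) * b) + 2 * c * (y * y)            ∎
  where
  open ≤-Reasoning
  eq : ∀ c a b u v → 2 * c * a * b + u + v ≡ u + 2 * c * (a * b) + v
  eq = solve-∀
... | no km≰2ca = begin
  4 * c * y * (b + d)                                                ≡⟨ eq₁ c y (b + d) ⟩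
  2 * c * (2 * ((b + d) * y))                                        ≤⟨ *-monoʳ-≤ (2 * c) (2xy≤x²+y² (b + d) y) ⟩
  2 * c * ((b + d) * (b + d) + y * y)                                ≡⟨ eq₂ c b d y ⟩
  2 * c * (b + d) * d + 2 * c * ((b + d) * b) + 2 * c * (y * y)      ≤⟨ +-monoˡ-≤ _ (+-monoˡ-≤ _ (*-monoˡ-≤ d (≰⇒≥ km≰2ca))) ⟩
  suc c * m * d + 2 * c * ((b + d) * b) + 2 * c * (y * y)            ∎
  where
  open ≤-Reasoning
  eq₁ : ∀ c y a → 4 * c * y * a ≡ 2 * c * (2 * (a * y))
  eq₁ = solve-∀
  eq₂ : ∀ c b d y → 2 * c * ((b + d) * (b + d) + y * y)
                  ≡ 2 * c * (b + d) * d + 2 * c * ((b + d) * b) + 2 * c * (y * y)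
  eq₂ = solve-∀

plane-inequality-≥ : ∀ c m y a b s → 1 ≤ c → c * y ≤ m → b ≤ a → a ≤ s → a ≤ m →
          suc c * m * (a + b) + 4 * c * y * s ≤ 2 * suc c * m * s + 2 * c * (a * b) + 2 * c * (y * y)
plane-inequality-≥ c m y a b s 1≤c cy≤m b≤a a≤s a≤m with m≤n⇒∃[o]m+o≡n b≤a | m≤n⇒∃[o]m+o≡n a≤s
... | d , refl | t , refl = begin
  suc c * m * (b + d + b) + 4 * c * y * (b + d + t)                                ≡⟨ eq₁ c m b d t y ⟩
  suc c * m * (b + d + b) + 4 * c * y * (b + d) + 4 * (c * y) * t                  ≤⟨ +-mono-≤ (+-monoʳ-≤ _ (plane-s≡a c m y b d cy≤m a≤m)) slope ⟩
  suc c * m * (b + d + b) + (suc c * m * d + 2 * c * ((b + d) * b) + 2 * c * (y * y)) + 2 * (suc c * m) * t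
                                                                                   ≡⟨ eq₂ c m b d t (2 * c * ((b + d) * b)) (2 * c * (y * y)) ⟩
  2 * suc c * m * (b + d + t) + 2 * c * ((b + d) * b) + 2 * c * (y * y)            ∎
  where
  open ≤-Reasoning
  -- Raising s by `t` above a costs `4 * c * y` per unit on the left and gains `2 * suc c * m` on
  -- the right; `c * y ≤ m` and `2 ≤ suc c` make the gain at least the cost.
  slope : 4 * (c * y) * t ≤ 2 * (suc c * m) * t
  slope = *-monoˡ-≤ t (begin
    4 * (c * y)      ≤⟨ *-monoʳ-≤ 4 cy≤m ⟩
    4 * m            ≡⟨ *-assoc 2 2 m ⟩
    2 * (2 * m)      ≤⟨ *-monoʳ-≤ 2 (*-monoˡ-≤ m (s≤s 1≤c)) ⟩
    2 * (suc c * m)  ∎)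
  eq₁ : ∀ c m b d t y → suc c * m * (b + d + b) + 4 * c * y * (b + d + t)
                      ≡ suc c * m * (b + d + b) + 4 * c * y * (b + d) + 4 * (c * y) * t
  eq₁ = solve-∀
  eq₂ : ∀ c m b d t u v → suc c * m * (b + d + b) + (suc c * m * d + u + v) + 2 * (suc c * m) * t
                        ≡ 2 * suc c * m * (b + d + t) + u + v
  eq₂ = solve-∀

plane-inequality : ∀ c m y a b s → 1 ≤ c → c * y ≤ m → a ≤ s → b ≤ s → a ≤ m → b ≤ m →
        suc c * m * (a + b) + 4 * c * y * s ≤ 2 * suc c * m * s + 2 * c * (a * b) + 2 * c * (y * y)
plane-inequality c m y a b s 1≤c cy≤m a≤s b≤s a≤m b≤m with ≤-total b a
... | inj₁ b≤a = plane-inequality-≥ c m y a b s 1≤c cy≤m b≤a a≤s a≤m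
... | inj₂ a≤b rewrite +-comm a b | *-comm a b = plane-inequality-≥ c m y b a s 1≤c cy≤m a≤b b≤s b≤m

-- Indicators and finite sums over one coordinate.

indicator : ∀ {p} {P : Set p} → Dec P → ℕ
indicator P? = if does P? then 1 else 0

∑-const : ∀ n x → ∑[ i < n ] x ≡ n * x
∑-const zero    x = refl
∑-const (suc n) x = cong (x +_) (∑-const n x)

∑-mono-≤ : ∀ {n} {f g : Fin n → ℕ} → (∀ i → f i ≤ g i) → sum f ≤ sum g
∑-mono-≤ {zero}  f≤g = z≤n
∑-mono-≤ {suc n} f≤g = +-mono-≤ (f≤g zero) (∑-mono-≤ (f≤g ∘ suc))

∑-bounded : ∀ {n} {f : Fin n → ℕ} → (∀ i → f i ≤ 1) → sum f ≤ n
∑-bounded {n} f≤1 = ≤-trans (∑-mono-≤ f≤1) (≤-reflexive (trans (∑-const n 1) (*-identityʳ n)))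

term≤∑ : ∀ {n} (f : Fin n → ℕ) i → f i ≤ sum f
term≤∑ f zero    = m≤m+n (f zero) _
term≤∑ f (suc i) = ≤-trans (term≤∑ (f ∘ suc) i) (m≤n+m _ (f zero))

∑-affine : ∀ {n} α β (f : Fin n → ℕ) → ∑[ i < n ] (α + β * f i) ≡ n * α + β * sum f
∑-affine {n} α β f = trans (∑-distrib-+ (λ _ → α) (λ i → β * f i))
  (cong₂ _+_ (∑-const n α) (sym (*-distribˡ-sum β f)))

-- Removing the `i`-th term from both sums leaves a termwise comparison. The removed terms are then
-- added crosswise, which avoids subtraction in ℕ.
∑-mono-off-diagonal : ∀ {n} (f g : Fin n → ℕ) i → (∀ j → i ≢ j → f j ≤ g j) →
                      sum f + g i ≤ sum g + f i
∑-mono-off-diagonal {suc n} f g i f≤g = begin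
  sum f + g i                      ≡⟨ cong (_+ g i) (sum-remove f) ⟩
  f i + sum (removeAt f i) + g i   ≤⟨ +-monoˡ-≤ (g i) (+-monoʳ-≤ (f i) (∑-mono-≤ (λ j → f≤g (punchIn i j) (punchInᵢ≢i i j ∘ sym)))) ⟩
  f i + sum (removeAt g i) + g i   ≡⟨ swap (f i) _ (g i) ⟩
  g i + sum (removeAt g i) + f i   ≡⟨ cong (_+ f i) (sum-remove g) ⟨
  sum g + f i                      ∎
  where
  open ≤-Reasoning
  swap : ∀ x y z → x + y + z ≡ z + y + x
  swap = solve-∀

∑-indicator-≟ : ∀ {n} (x : Fin n) → ∑[ y < n ] indicator (x ≟ y) ≡ 1
∑-indicator-≟ {suc n} zero    = cong suc (sum-replicate-zero n)
∑-indicator-≟ {suc n} (suc x) = ∑-indicator-≟ x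

-- Sums over all points of the grid.

-- Recursion on the dimension, instead of a sum over `allPoints`, lets linearity and exchange of
-- summation follow coordinate by coordinate.
∑ₚ : ∀ {n k} → (Point n k → ℕ) → ℕ
∑ₚ {k = zero}      f = f []
∑ₚ {n} {k = suc k} f = ∑[ x < n ] ∑ₚ (λ p → f (x ∷ p))

∑ₚ-cong : ∀ {n k} {f g : Point n k → ℕ} → (∀ p → f p ≡ g p) → ∑ₚ f ≡ ∑ₚ g
∑ₚ-cong {k = zero}  f≗g = f≗g []
∑ₚ-cong {k = suc k} f≗g = sum-cong-≗ (λ x → ∑ₚ-cong (λ p → f≗g (x ∷ p)))

∑ₚ-mono-≤ : ∀ {n k} {f g : Point n k → ℕ} → (∀ p → f p ≤ g p) → ∑ₚ f ≤ ∑ₚ g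
∑ₚ-mono-≤ {k = zero}  f≤g = f≤g []
∑ₚ-mono-≤ {k = suc k} f≤g = ∑-mono-≤ (λ x → ∑ₚ-mono-≤ (λ p → f≤g (x ∷ p)))

∑ₚ-distrib-+ : ∀ {n k} (f g : Point n k → ℕ) → ∑ₚ (λ p → f p + g p) ≡ ∑ₚ f + ∑ₚ g
∑ₚ-distrib-+ {k = zero}  f g = refl
∑ₚ-distrib-+ {k = suc k} f g = trans
  (sum-cong-≗ (λ x → ∑ₚ-distrib-+ (λ p → f (x ∷ p)) (λ p → g (x ∷ p))))
  (∑-distrib-+ (λ x → ∑ₚ (λ p → f (x ∷ p))) (λ x → ∑ₚ (λ p → g (x ∷ p))))

*-distribˡ-∑ₚ : ∀ {n k} α (f : Point n k → ℕ) → ∑ₚ (λ p → α * f p) ≡ α * ∑ₚ f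
*-distribˡ-∑ₚ {k = zero}  α f = refl
*-distribˡ-∑ₚ {k = suc k} α f = trans
  (sum-cong-≗ (λ x → *-distribˡ-∑ₚ α (λ p → f (x ∷ p))))
  (sym (*-distribˡ-sum α (λ x → ∑ₚ (λ p → f (x ∷ p)))))

∑ₚ-const : ∀ {n} k α → ∑ₚ {n} {k} (λ _ → α) ≡ n ^ k * α
∑ₚ-const     zero    α = sym (*-identityˡ α)
∑ₚ-const {n} (suc k) α = begin
  ∑[ x < n ] ∑ₚ {n} {k} (λ _ → α)  ≡⟨ ∑-const n _ ⟩
  n * ∑ₚ {n} {k} (λ _ → α)         ≡⟨ cong (n *_) (∑ₚ-const k α) ⟩
  n * (n ^ k * α)                  ≡⟨ *-assoc n _ α ⟨
  n ^ suc k * α                    ∎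
  where open ≡-Reasoning

∑ₚ-∑-comm : ∀ {n k m} (f : Point n k → Fin m → ℕ) →
            ∑ₚ (λ p → ∑[ i < m ] f p i) ≡ ∑[ i < m ] ∑ₚ (λ p → f p i)
∑ₚ-∑-comm {k = zero}  f = refl
∑ₚ-∑-comm {k = suc k} f = trans
  (sum-cong-≗ (λ x → ∑ₚ-∑-comm (λ p → f (x ∷ p))))
  (∑-comm (λ x i → ∑ₚ (λ p → f (x ∷ p) i)))

-- List sums, and the passage from `allPoints` to `∑ₚ`.

∑ₗ : ∀ {A : Set} → (A → ℕ) → List A → ℕ
∑ₗ f xs = List.sum (map f xs)

length-filter-∑ₗ : ∀ {A : Set} {P : A → Set} (P? : ∀ x → Dec (P x)) xs →
                   length (filter P? xs) ≡ ∑ₗ (indicator ∘ P?) xs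
length-filter-∑ₗ P? []       = refl
length-filter-∑ₗ P? (x ∷ xs) with does (P? x)
... | true  = cong suc (length-filter-∑ₗ P? xs)
... | false = length-filter-∑ₗ P? xs

∑ₗ-map : ∀ {A B : Set} (f : B → ℕ) (g : A → B) xs → ∑ₗ f (map g xs) ≡ ∑ₗ (f ∘ g) xs
∑ₗ-map f g xs = cong List.sum (sym (map-∘ xs))

∑ₗ-concatMap : ∀ {A B : Set} (f : B → ℕ) (g : A → List B) xs →
               ∑ₗ f (concatMap g xs) ≡ ∑ₗ (λ x → ∑ₗ f (g x)) xs
∑ₗ-concatMap f g []       = refl
∑ₗ-concatMap f g (x ∷ xs) = begin
  List.sum (map f (g x ++ concatMap g xs))            ≡⟨ cong List.sum (map-++ f (g x) _) ⟩
  List.sum (map f (g x) ++ map f (concatMap g xs))    ≡⟨ sum-++ (map f (g x)) _ ⟩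
  ∑ₗ f (g x) + ∑ₗ f (concatMap g xs)                  ≡⟨ cong (∑ₗ f (g x) +_) (∑ₗ-concatMap f g xs) ⟩
  ∑ₗ f (g x) + ∑ₗ (λ x → ∑ₗ f (g x)) xs               ∎
  where open ≡-Reasoning

∑ₗ-allFinList : ∀ {n} (f : Fin n → ℕ) → ∑ₗ f (allFinList n) ≡ sum f
∑ₗ-allFinList {zero}  f = refl
∑ₗ-allFinList {suc n} f = cong (f zero +_)
  (trans (∑ₗ-map f suc (allFinList n)) (∑ₗ-allFinList (f ∘ suc)))

∑ₗ-allPoints : ∀ {n k} (f : Point n k → ℕ) → ∑ₗ f (allPoints n k) ≡ ∑ₚ f
∑ₗ-allPoints {n} {zero}  f = +-identityʳ (f [])
∑ₗ-allPoints {n} {suc k} f = begin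
  ∑ₗ f (allPoints n (suc k))                                          ≡⟨ ∑ₗ-concatMap f (λ x → map (x ∷_) (allPoints n k)) (allFinList n) ⟩
  ∑ₗ (λ x → ∑ₗ f (map (x ∷_) (allPoints n k))) (allFinList n)         ≡⟨ ∑ₗ-allFinList (λ x → ∑ₗ f (map (x ∷_) (allPoints n k))) ⟩
  ∑[ x < n ] ∑ₗ f (map (x ∷_) (allPoints n k))                        ≡⟨ sum-cong-≗ (λ x → trans (∑ₗ-map f (x ∷_) (allPoints n k)) (∑ₗ-allPoints (f ∘ (x ∷_)))) ⟩
  ∑[ x < n ] ∑ₚ (λ p → f (x ∷ p))                                     ∎
  where open ≡-Reasoning

-- The rooks as a weight function on points.

δ : ∀ {n k} → Point n k → Point n k → ℕ
δ []       []       = 1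
δ (x ∷ xs) (y ∷ ys) = indicator (x ≟ y) * δ xs ys

δ-refl : ∀ {n k} (x : Point n k) → δ x x ≡ 1
δ-refl []       = refl
δ-refl (x ∷ xs) with x ≟ x
... | yes _   = trans (+-identityʳ _) (δ-refl xs)
... | no  x≢x = contradiction refl x≢x

∑ₚ-δ : ∀ {n k} (x : Point n k) → ∑ₚ (δ x) ≡ 1
∑ₚ-δ         []       = refl
∑ₚ-δ {n} (x ∷ xs) = begin
  ∑[ y < n ] ∑ₚ (λ ys → indicator (x ≟ y) * δ xs ys)  ≡⟨ sum-cong-≗ (λ y → *-distribˡ-∑ₚ (indicator (x ≟ y)) (δ xs)) ⟩
  ∑[ y < n ] (indicator (x ≟ y) * ∑ₚ (δ xs))          ≡⟨ sum-cong-≗ (λ y → trans (cong (indicator (x ≟ y) *_) (∑ₚ-δ xs)) (*-identityʳ _)) ⟩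
  ∑[ y < n ] indicator (x ≟ y)                        ≡⟨ ∑-indicator-≟ x ⟩
  1                                                   ∎
  where open ≡-Reasoning

-- Turning the list into a weight makes the rook counts of lines and planes plain sums, and the
-- total weight is the length of the list.
multiplicity : ∀ {n k} → List (Point n k) → Point n k → ℕ
multiplicity R p = ∑ₗ (λ x → δ x p) R

∑ₚ-multiplicity : ∀ {n k} (R : List (Point n k)) → ∑ₚ (multiplicity R) ≡ length R
∑ₚ-multiplicity {n} {k} []      = trans (∑ₚ-const {n} k 0) (*-zeroʳ (n ^ k))
∑ₚ-multiplicity         (x ∷ R) = trans (∑ₚ-distrib-+ (δ x) (multiplicity R))
  (cong₂ _+_ (∑ₚ-δ x) (∑ₚ-multiplicity R))

-- Sums along axis-parallel lines and planes.

lineSum : ∀ {n k} → (Point n k → ℕ) → Fin k → Point n k → ℕ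
lineSum {n} f i p = ∑[ a < n ] f (p [ i ]≔ a)

-- Every point lies on the `i`-lines of exactly `n` points, namely those of its own `i`-line, so its
-- value is counted `n` times.
∑ₚ-lineSum : ∀ {n k} (f : Point n k → ℕ) i → ∑ₚ (lineSum f i) ≡ n * ∑ₚ f
∑ₚ-lineSum {n} {suc k} f zero = begin
  ∑[ x < n ] ∑ₚ (λ p → ∑[ a < n ] f (a ∷ p))   ≡⟨ ∑-const n _ ⟩
  n * ∑ₚ (λ p → ∑[ a < n ] f (a ∷ p))          ≡⟨ cong (n *_) (∑ₚ-∑-comm (λ p a → f (a ∷ p))) ⟩
  n * ∑ₚ f                                     ∎
  where open ≡-Reasoning
∑ₚ-lineSum {n} {suc k} f (suc i) = begin
  ∑[ x < n ] ∑ₚ (lineSum (λ p → f (x ∷ p)) i)  ≡⟨ sum-cong-≗ (λ x → ∑ₚ-lineSum (λ p → f (x ∷ p)) i) ⟩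
  ∑[ x < n ] (n * ∑ₚ (λ p → f (x ∷ p)))        ≡⟨ *-distribˡ-sum n (λ x → ∑ₚ (λ p → f (x ∷ p))) ⟨
  n * ∑ₚ f                                     ∎
  where open ≡-Reasoning

lineSum-comm : ∀ {n k} (f : Point n k → ℕ) {i j} → i ≢ j → ∀ p →
               lineSum (lineSum f j) i p ≡ lineSum (lineSum f i) j p
lineSum-comm {n} f {i} {j} i≢j p = trans
  (sum-cong-≗ {n} (λ a → sum-cong-≗ {n} (λ b → cong f ([]≔-commutes p i j i≢j))))
  (∑-comm (λ a b → f ((p [ j ]≔ b) [ i ]≔ a)))

-- This is eᵢ(p): truncation at 1 records whether the line holds a rook at all.
occupied : ∀ {n k} → (Point n k → ℕ) → Fin k → Point n k → ℕ
occupied r i p = 1 ⊓ lineSum r i p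

occupied-≤1 : ∀ {n k} (r : Point n k → ℕ) i p → occupied r i p ≤ 1
occupied-≤1 r i p = m⊓n≤m 1 _

occupied-[]≔ : ∀ {n k} (r : Point n k → ℕ) i p a → occupied r i (p [ i ]≔ a) ≡ occupied r i p
occupied-[]≔ {n} r i p a = cong (1 ⊓_) (sum-cong-≗ {n} (λ b → cong r ([]≔-idempotent p i)))

-- Within a plane of directions `i` and `j`, `occupied r i` depends only on the `j`-coordinate and
-- `occupied r j` only on the `i`-coordinate, so the double sum of their product factors. This is
-- the count a b of crossings in one plane.
occupied-product : ∀ {n k} (r : Point n k → ℕ) {i j} → i ≢ j → ∀ p →
  lineSum (lineSum (λ q → occupied r i q * occupied r j q) j) i p ≡
  lineSum (occupied r i) j p * lineSum (occupied r j) i p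
occupied-product {n} r {i} {j} i≢j p = begin
  ∑[ a < n ] ∑[ b < n ] (occupied r i ((p [ i ]≔ a) [ j ]≔ b) * occupied r j ((p [ i ]≔ a) [ j ]≔ b))
    ≡⟨ sum-cong-≗ (λ a → sum-cong-≗ (λ b → cong₂ _*_
         (trans (cong (occupied r i) ([]≔-commutes p i j i≢j)) (occupied-[]≔ r i (p [ j ]≔ b) a))
         (occupied-[]≔ r j (p [ i ]≔ a) b))) ⟩
  ∑[ a < n ] ∑[ b < n ] (occupied r i (p [ j ]≔ b) * occupied r j (p [ i ]≔ a))
    ≡⟨ sum-cong-≗ (λ a → *-distribʳ-sum (occupied r j (p [ i ]≔ a)) (λ b → occupied r i (p [ j ]≔ b))) ⟨
  ∑[ a < n ] (lineSum (occupied r i) j p * occupied r j (p [ i ]≔ a))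
    ≡⟨ *-distribˡ-sum (lineSum (occupied r i) j p) (λ a → occupied r j (p [ i ]≔ a)) ⟨
  lineSum (occupied r i) j p * lineSum (occupied r j) i p
    ∎
  where open ≡-Reasoning

∑ₚ-lineSum² : ∀ {n k} (f : Point n k → ℕ) i j → ∑ₚ (lineSum (lineSum f j) i) ≡ n * (n * ∑ₚ f)
∑ₚ-lineSum² {n} f i j = trans (∑ₚ-lineSum (lineSum f j) i) (cong (n *_) (∑ₚ-lineSum f j))

-- Global counts of occupied lines and of their crossings.

module _ {n k : ℕ} (r : Point n k → ℕ) where

  -- Points are counted here, so each occupied line of direction `i` contributes `n`.
  lines : Fin k → ℕ
  lines i = ∑ₚ (occupied r i)

  crossings : Fin k → Fin k → ℕ
  crossings i j = ∑ₚ (λ p → occupied r i p * occupied r j p)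

  directions : Point n k → ℕ
  directions p = ∑[ i < k ] occupied r i p

  ∑ₚ-directions : ∑ₚ directions ≡ sum lines
  ∑ₚ-directions = ∑ₚ-∑-comm (λ p i → occupied r i p)

  ∑ₚ-directions² : ∑ₚ (λ p → directions p * directions p) ≡ ∑[ i < k ] ∑[ j < k ] crossings i j
  ∑ₚ-directions² = begin
    ∑ₚ (λ p → directions p * directions p)
      ≡⟨ ∑ₚ-cong (λ p → *-distribʳ-sum (directions p) (λ i → occupied r i p)) ⟩
    ∑ₚ (λ p → ∑[ i < k ] (occupied r i p * directions p))
      ≡⟨ ∑ₚ-∑-comm (λ p i → occupied r i p * directions p) ⟩
    ∑[ i < k ] ∑ₚ (λ p → occupied r i p * directions p)
      ≡⟨ sum-cong-≗ (λ i → ∑ₚ-cong (λ p → *-distribˡ-sum (occupied r i p) (λ j → occupied r j p))) ⟩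
    ∑[ i < k ] ∑ₚ (λ p → ∑[ j < k ] (occupied r i p * occupied r j p))
      ≡⟨ sum-cong-≗ (λ i → ∑ₚ-∑-comm (λ p j → occupied r i p * occupied r j p)) ⟩
    ∑[ i < k ] ∑[ j < k ] crossings i j
      ∎
    where open ≡-Reasoning

  crossings-diagonal : ∀ i → crossings i i ≡ lines i
  crossings-diagonal i = ∑ₚ-cong (λ p → idem (lineSum r i p))
    where
    idem : ∀ m → (1 ⊓ m) * (1 ⊓ m) ≡ 1 ⊓ m
    idem zero    = refl
    idem (suc m) = refl

  lines-≤ : ∀ i → lines i ≤ n * ∑ₚ r
  lines-≤ i = ≤-trans (∑ₚ-mono-≤ {n} {k} (λ p → m⊓n≤n 1 _)) (≤-reflexive (∑ₚ-lineSum r i))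

-- Lower bound for the crossings of two directions.

module _ {n c′ : ℕ} (r : Point n (suc (suc c′)) → ℕ) .{{_ : NonZero n}} where

  private
    c k N W : ℕ
    c = suc c′
    k = suc c
    N = ∑ₚ r
    W = n ^ c′

  -- Scaled by W, the number of planes in a given pair of directions, so that the
  -- average N / W becomes the integer N.
  plane-at : ∀ {i j} → i ≢ j → c * N ≤ W * n → ∀ p →
    let s = lineSum (lineSum r j) i p
        a = lineSum (occupied r i) j p
        b = lineSum (occupied r j) i p
    in suc c * (W * n) * (W * a + W * b) + 4 * c * N * (W * s)
       ≤ 2 * suc c * (W * n) * (W * s) + 2 * c * (W * a * (W * b)) + 2 * c * (N * N)
  plane-at {i} {j} i≢j cN≤Wn p = plane-inequality c (W * n) N _ _ _ (s≤s z≤n) cN≤Wn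
    (*-monoʳ-≤ W (≤-trans (∑-mono-≤ {n} (λ b → m⊓n≤n 1 _)) (≤-reflexive (sym (lineSum-comm r i≢j p)))))
    (*-monoʳ-≤ W (∑-mono-≤ {n} (λ a → m⊓n≤n 1 _)))
    (*-monoʳ-≤ W (∑-bounded (λ b → occupied-≤1 r i (p [ j ]≔ b))))
    (*-monoʳ-≤ W (∑-bounded (λ a → occupied-≤1 r j (p [ i ]≔ a))))

  -- Summing `plane-at` over all `p` meets each plane `n * n` times, once per point, and
  -- `occupied-product` turns the products a b into crossings. All terms then share the factor
  -- `W * n * n`, which equals `n ^ k`; the constant `ζ` cancels half of the term coming from
  -- `4 * c * N * (W * s)`.
  crossings-≥ : ∀ {i j} → i ≢ j → c * N ≤ W * n →
    k * W * (lines r i + lines r j) + 2 * c * (N * N) ≤ 2 * k * W * n * N + 2 * c * W * crossings r i j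
  crossings-≥ {i} {j} i≢j cN≤Wn = cancel (begin
    α * (n * lines r i) + α * (n * lines r j) + β * (n * (n * N))
      ≡⟨ cong₂ _+_ (cong₂ _+_ (cong (α *_) (∑ₚ-lineSum (occupied r i) j)) (cong (α *_) (∑ₚ-lineSum (occupied r j) i)))
                   (cong (β *_) (∑ₚ-lineSum² r i j)) ⟨
    α * ∑ₚ a + α * ∑ₚ b + β * ∑ₚ s
      ≡⟨ cong₂ _+_ (cong₂ _+_ (*-distribˡ-∑ₚ α a) (*-distribˡ-∑ₚ α b)) (*-distribˡ-∑ₚ β s) ⟨
    ∑ₚ (λ p → α * a p) + ∑ₚ (λ p → α * b p) + ∑ₚ (λ p → β * s p)
      ≡⟨ cong (_+ ∑ₚ (λ p → β * s p)) (∑ₚ-distrib-+ (λ p → α * a p) (λ p → α * b p)) ⟨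
    ∑ₚ (λ p → α * a p + α * b p) + ∑ₚ (λ p → β * s p)
      ≡⟨ ∑ₚ-distrib-+ (λ p → α * a p + α * b p) (λ p → β * s p) ⟨
    ∑ₚ (λ p → α * a p + α * b p + β * s p)
      ≤⟨ ∑ₚ-mono-≤ at ⟩
    ∑ₚ (λ p → γ * s p + ε * x p + ζ)
      ≡⟨ ∑ₚ-distrib-+ (λ p → γ * s p + ε * x p) (λ p → ζ) ⟩
    ∑ₚ (λ p → γ * s p + ε * x p) + ∑ₚ {n} {k} (λ p → ζ)
      ≡⟨ cong₂ _+_ (∑ₚ-distrib-+ (λ p → γ * s p) (λ p → ε * x p)) (∑ₚ-const {n} k ζ) ⟩
    ∑ₚ (λ p → γ * s p) + ∑ₚ (λ p → ε * x p) + n ^ k * ζ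
      ≡⟨ cong (_+ n ^ k * ζ) (cong₂ _+_ (*-distribˡ-∑ₚ γ s) (*-distribˡ-∑ₚ ε x)) ⟩
    γ * ∑ₚ s + ε * ∑ₚ x + n ^ k * ζ
      ≡⟨ cong (_+ n ^ k * ζ) (cong₂ _+_ (cong (γ *_) (∑ₚ-lineSum² r i j))
           (cong (ε *_) (∑ₚ-lineSum² (λ p → occupied r i p * occupied r j p) i j))) ⟩
    γ * (n * (n * N)) + ε * (n * (n * crossings r i j)) + n ^ k * ζ
      ∎)
    where
    open ≤-Reasoning
    a b s x : Point n k → ℕ
    a = lineSum (occupied r i) j
    b = lineSum (occupied r j) i
    s = lineSum (lineSum r j) i
    x = lineSum (lineSum (λ p → occupied r i p * occupied r j p) j) i
    α β γ ε ζ : ℕ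
    α = suc c * (W * n) * W
    β = 4 * c * N * W
    γ = 2 * suc c * (W * n) * W
    ε = 2 * c * (W * W)
    ζ = 2 * c * (N * N)
    eqˡ : ∀ c m N W a b s → suc c * m * W * a + suc c * m * W * b + 4 * c * N * W * s
                          ≡ suc c * m * (W * a + W * b) + 4 * c * N * (W * s)
    eqˡ = solve-∀
    eqʳ : ∀ c m W a b s ζ → 2 * suc c * m * (W * s) + 2 * c * (W * a * (W * b)) + ζ
                          ≡ 2 * suc c * m * W * s + 2 * c * (W * W) * (a * b) + ζ
    eqʳ = solve-∀
    at : ∀ p → α * a p + α * b p + β * s p ≤ γ * s p + ε * x p + ζ
    at p = begin
      α * a p + α * b p + β * s p            ≡⟨ eqˡ c (W * n) N W (a p) (b p) (s p) ⟩
      _                                      ≤⟨ plane-at i≢j cN≤Wn p ⟩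
      _                                      ≡⟨ eqʳ c (W * n) W (a p) (b p) (s p) ζ ⟩
      γ * s p + ε * (a p * b p) + ζ          ≡⟨ cong (λ y → γ * s p + ε * y + ζ) (occupied-product r i≢j p) ⟨
      γ * s p + ε * x p + ζ                  ∎
    instance
      Wnn≢0 : NonZero (W * n * n)
      Wnn≢0 = m*n≢0 (W * n) n {{m*n≢0 W n {{m^n≢0 n c′}}}}
    cancelˡ : ∀ c n N W a b → suc c * (W * n) * W * (n * a) + suc c * (W * n) * W * (n * b) + 4 * c * N * W * (n * (n * N))
                            ≡ W * n * n * (suc c * W * (a + b) + 2 * c * (N * N)) + W * n * n * (2 * c * (N * N))
    cancelˡ = solve-∀
    cancelʳ : ∀ c n N W x → 2 * suc c * (W * n) * W * (n * (n * N)) + 2 * c * (W * W) * (n * (n * x)) + n * (n * W) * (2 * c * (N * N))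
                          ≡ W * n * n * (2 * suc c * W * n * N + 2 * c * W * x) + W * n * n * (2 * c * (N * N))
    cancelʳ = solve-∀
    cancel : ∀ {u v x} → α * (n * u) + α * (n * v) + β * (n * (n * N)) ≤ γ * (n * (n * N)) + ε * (n * (n * x)) + n ^ k * ζ →
             k * W * (u + v) + 2 * c * (N * N) ≤ 2 * k * W * n * N + 2 * c * W * x
    cancel {u} {v} {x} le = *-cancelˡ-≤ (W * n * n) (+-cancelʳ-≤ (W * n * n * ζ) _ _ (begin
      _  ≡⟨ cancelˡ c n N W u v ⟨
      _  ≤⟨ le ⟩
      _  ≡⟨ cancelʳ c n N W x ⟩
      _  ∎))

-- Covered points and the occupied lines through them.

hamming≤0⇒≡ : ∀ {n k} (x p : Point n k) → hamming x p ≤ 0 → x ≡ p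
hamming≤0⇒≡ []       []       _ = refl
hamming≤0⇒≡ (x ∷ xs) (y ∷ ys) h with x ≟ y
... | yes refl = cong (x ∷_) (hamming≤0⇒≡ xs ys h)

hamming≤1⇒≡[]≔ : ∀ {n c} (x p : Point n (suc c)) → hamming x p ≤ 1 →
                 ∃[ i ] ∃[ a ] p [ i ]≔ a ≡ x
-- In dimension one, overwriting the only coordinate reaches every point. The recursion also ends
-- here when `x` equals `p`, which is thus `p` with its last coordinate rewritten.
hamming≤1⇒≡[]≔ {c = zero}  (x ∷ [])  (y ∷ [])  _ = zero , x , refl
hamming≤1⇒≡[]≔ {c = suc c} (x ∷ xs) (y ∷ ys) h with x ≟ y | h
... | yes refl | h′     = let i , a , eq = hamming≤1⇒≡[]≔ xs ys h′ in suc i , a , cong (x ∷_) eq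
... | no  _    | s≤s h′ = zero , x , cong (x ∷_) (sym (hamming≤0⇒≡ xs ys h′))

Covered : ∀ {n k} → List (Point n k) → Point n k → Set
Covered R p = Any (λ x → hamming x p ≤ 1) R

covered? : ∀ {n k} (R : List (Point n k)) p → Dec (Covered R p)
covered? R p = any? (λ x → hamming x p ≤? 1) R

covered⇒multiplicity≥1 : ∀ {n c} {R : List (Point n (suc c))} {p} → Covered R p →
                         ∃[ i ] ∃[ a ] 1 ≤ multiplicity R (p [ i ]≔ a)
covered⇒multiplicity≥1 {R = x ∷ _} {p} (here h) with hamming≤1⇒≡[]≔ x p h
... | i , a , refl = i , a , ≤-trans (≤-reflexive (sym (δ-refl x))) (m≤m+n _ _)
covered⇒multiplicity≥1 (there h) with covered⇒multiplicity≥1 h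
... | i , a , le = i , a , ≤-trans le (m≤n+m _ _)

coveredCount≡∑ₚ : ∀ {n k} (R : List (Point n k)) → coveredCount R ≡ ∑ₚ (indicator ∘ covered? R)
coveredCount≡∑ₚ {n} {k} R = trans (length-filter-∑ₗ (covered? R) (allPoints n k))
  (∑ₗ-allPoints (indicator ∘ covered? R))

coveredCount≤n^k : ∀ {n k} (R : List (Point n k)) → coveredCount R ≤ n ^ k
coveredCount≤n^k {n} {k} R = begin
  coveredCount R                  ≡⟨ coveredCount≡∑ₚ R ⟩
  ∑ₚ (indicator ∘ covered? R)     ≤⟨ ∑ₚ-mono-≤ {n} {k} (λ p → indicator≤1 (covered? R p)) ⟩
  ∑ₚ {n} {k} (λ _ → 1)            ≡⟨ ∑ₚ-const {n} k 1 ⟩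
  n ^ k * 1                       ≡⟨ *-identityʳ (n ^ k) ⟩
  n ^ k                           ∎
  where
  open ≤-Reasoning
  indicator≤1 : ∀ {P : Set} (P? : Dec P) → indicator P? ≤ 1
  indicator≤1 (yes _) = ≤-refl
  indicator≤1 (no _)  = z≤n

module _ {n c : ℕ} (R : List (Point n (suc c))) where

  private
    k : ℕ
    k = suc c
    r : Point n k → ℕ
    r = multiplicity R

  covered⇒directions≥1 : ∀ {p} → Covered R p → 1 ≤ directions r p
  covered⇒directions≥1 {p} cov with covered⇒multiplicity≥1 cov
  ... | i , a , le = ≤-trans
    (⊓-glb ≤-refl (≤-trans le (term≤∑ (λ a → r (p [ i ]≔ a)) a)))
    (term≤∑ (λ i → occupied r i p) i)

  coveredCount≤∑lines : coveredCount R ≤ sum (lines r)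
  coveredCount≤∑lines = begin
    coveredCount R                 ≡⟨ coveredCount≡∑ₚ R ⟩
    ∑ₚ (indicator ∘ covered? R)    ≤⟨ ∑ₚ-mono-≤ pointwise ⟩
    ∑ₚ (directions r)              ≡⟨ ∑ₚ-directions r ⟩
    sum (lines r)                  ∎
    where
    open ≤-Reasoning
    pointwise : ∀ p → indicator (covered? R p) ≤ directions r p
    pointwise p with covered? R p
    ... | yes cov = covered⇒directions≥1 cov
    ... | no  _   = z≤n

  coveredCount+crossings≤ : k * coveredCount R + ∑[ i < k ] ∑[ j < k ] crossings r i j ≤ suc k * sum (lines r)
  coveredCount+crossings≤ = begin
    k * coveredCount R + ∑[ i < k ] ∑[ j < k ] crossings r i j
      ≡⟨ cong₂ _+_ (trans (cong (k *_) (coveredCount≡∑ₚ R)) (sym (*-distribˡ-∑ₚ k (indicator ∘ covered? R))))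
                   (sym (∑ₚ-directions² r)) ⟩
    ∑ₚ (λ p → k * indicator (covered? R p)) + ∑ₚ (λ p → e p * e p)
      ≡⟨ ∑ₚ-distrib-+ (λ p → k * indicator (covered? R p)) (λ p → e p * e p) ⟨
    ∑ₚ (λ p → k * indicator (covered? R p) + e p * e p)
      ≤⟨ ∑ₚ-mono-≤ pointwise ⟩
    ∑ₚ (λ p → suc k * e p)
      ≡⟨ *-distribˡ-∑ₚ (suc k) e ⟩
    suc k * ∑ₚ e
      ≡⟨ cong (suc k *_) (∑ₚ-directions r) ⟩
    suc k * sum (lines r)
      ∎
    where
    open ≤-Reasoning
    e : Point n k → ℕ
    e = directions r
    e≤k : ∀ p → e p ≤ k
    e≤k p = ∑-bounded (λ i → occupied-≤1 r i p)
    pointwise : ∀ p → k * indicator (covered? R p) + e p * e p ≤ suc k * e p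
    pointwise p with covered? R p
    ... | yes cov = begin
      k * 1 + e p * e p        ≡⟨ +-comm (k * 1) _ ⟩
      -- The chord inequality at `x = 1`, `v = e p`, that is (e - 1)(e - k) ≤ 0.
      e p * e p + k * (1 * 1)  ≤⟨ square-below-chord k 1 (e p) (covered⇒directions≥1 cov) (≤-trans (e≤k p) (≤-reflexive (sym (*-identityʳ k)))) ⟩
      suc k * (1 * e p)        ≡⟨ cong (suc k *_) (*-identityˡ (e p)) ⟩
      suc k * e p              ∎
    -- The indicator vanishes, so `e p ≤ k` already gives the bound.
    ... | no _ = begin
      k * 0 + e p * e p        ≡⟨ cong (_+ e p * e p) (*-zeroʳ k) ⟩
      e p * e p                ≤⟨ *-monoˡ-≤ (e p) (m≤n⇒m≤1+n (e≤k p)) ⟩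
      suc k * e p              ∎

-- Summation over pairs of directions and elimination of the crossings.

-- The pair bounds are summed over ordered pairs `i ≠ j`, first along each row. The double sums stay
-- complete because each diagonal term is added on the opposite side, where `Q i i` is replaced by
-- `E i`. In the application `H` is `2 * c * (N * N)` and `G` is `2 * suc c * W * n * N`.
∑-off-diagonal : ∀ c W H G (E : Fin (suc c) → ℕ) (Q : Fin (suc c) → Fin (suc c) → ℕ) →
  (∀ i → Q i i ≡ E i) →
  (∀ {i j} → i ≢ j → suc c * W * (E i + E j) + H ≤ G + 2 * c * W * Q i j) →
  suc c * (suc c * H + suc c * W * sum E + G) + (suc c * suc c * W + 2 * c * W) * sum E ≤
  suc c * (suc c * G + H) + 2 * c * W * (∑[ i < suc c ] ∑[ j < suc c ] Q i j) + 2 * suc c * W * sum E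
∑-off-diagonal c W H G E Q diagonal off = begin
  k * (k * H + k * W * X + G) + (k * k * W + 2 * c * W) * X
    ≡⟨ ∑-affine (k * H + k * W * X + G) (k * k * W + 2 * c * W) E ⟨
  ∑[ i < k ] (k * H + k * W * X + G + (k * k * W + 2 * c * W) * E i)
    ≤⟨ ∑-mono-≤ row ⟩
  ∑[ i < k ] (k * G + H + 2 * c * W * sum (Q i) + 2 * k * W * E i)
    ≡⟨ ∑-distrib-+ (λ i → k * G + H + 2 * c * W * sum (Q i)) (λ i → 2 * k * W * E i) ⟩
  ∑[ i < k ] (k * G + H + 2 * c * W * sum (Q i)) + ∑[ i < k ] (2 * k * W * E i)
    ≡⟨ cong₂ _+_ (∑-affine (k * G + H) (2 * c * W) (λ i → sum (Q i))) (sym (*-distribˡ-sum (2 * k * W) E)) ⟩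
  k * (k * G + H) + 2 * c * W * (∑[ i < k ] sum (Q i)) + 2 * k * W * X
    ∎
  where
  open ≤-Reasoning
  k X : ℕ
  k = suc c
  X = sum E
  eq₁ : ∀ c W H G X e → suc c * H + suc c * W * X + G + (suc c * suc c * W + 2 * c * W) * e
                      ≡ suc c * (suc c * W * e + H) + suc c * W * X + (G + 2 * c * W * e)
  eq₁ = solve-∀
  eq₂ : ∀ c W H G S e → suc c * G + 2 * c * W * S + (suc c * W * (e + e) + H)
                      ≡ suc c * G + H + 2 * c * W * S + 2 * suc c * W * e
  eq₂ = solve-∀
  split : ∀ u h x y → u * (x + y) + h ≡ u * x + h + u * y
  split = solve-∀
  row : ∀ i → k * H + k * W * X + G + (k * k * W + 2 * c * W) * E i
            ≤ k * G + H + 2 * c * W * sum (Q i) + 2 * k * W * E i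
  row i = begin
    k * H + k * W * X + G + (k * k * W + 2 * c * W) * E i
      ≡⟨ eq₁ c W H G X (E i) ⟩
    k * (k * W * E i + H) + k * W * X + (G + 2 * c * W * E i)
      ≡⟨ cong₂ _+_ (trans (sym (∑-affine (k * W * E i + H) (k * W) E)) (sum-cong-≗ (λ j → sym (split (k * W) H (E i) (E j)))))
                   (cong (λ q → G + 2 * c * W * q) (sym (diagonal i))) ⟩
    ∑[ j < k ] (k * W * (E i + E j) + H) + (G + 2 * c * W * Q i i)
      ≤⟨ ∑-mono-off-diagonal (λ j → k * W * (E i + E j) + H) (λ j → G + 2 * c * W * Q i j) i (λ j → off) ⟩
    ∑[ j < k ] (G + 2 * c * W * Q i j) + (k * W * (E i + E i) + H)
      ≡⟨ cong (_+ (k * W * (E i + E i) + H)) (∑-affine G (2 * c * W) (Q i)) ⟩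
    k * G + 2 * c * W * sum (Q i) + (k * W * (E i + E i) + H)
      ≡⟨ eq₂ c W H G (sum (Q i)) (E i) ⟩
    k * G + H + 2 * c * W * sum (Q i) + 2 * k * W * E i
      ∎

-- Adding `2 * c * W` times the second inequality to the first cancels `Y`, and also `X`, because 2
-- k + 2 c k = 2 k² for k = c + 1. What remains is the conclusion multiplied by k c.
eliminate-crossings : ∀ c W H G X Y C .{{_ : NonZero c}} →
  suc c * (suc c * H + suc c * W * X + G) + (suc c * suc c * W + 2 * c * W) * X ≤
    suc c * (suc c * G + H) + 2 * c * W * Y + 2 * suc c * W * X →
  suc c * C + Y ≤ suc (suc c) * X →
  H + 2 * W * C ≤ G
eliminate-crossings c W H G X Y C le₁ le₂ =
  *-cancelˡ-≤ (suc c * c) {{m*n≢0 (suc c) c}} (+-cancelʳ-≤ Z _ _ (begin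
    suc c * c * (H + 2 * W * C) + Z                        ≡⟨ eq₁ c W H G X Y C ⟩
    suc c * (suc c * H + suc c * W * X + G) + (suc c * suc c * W + 2 * c * W) * X + 2 * c * W * (suc c * C + Y)
                                                           ≤⟨ +-mono-≤ le₁ (*-monoʳ-≤ (2 * c * W) le₂) ⟩
    suc c * (suc c * G + H) + 2 * c * W * Y + 2 * suc c * W * X + 2 * c * W * (suc (suc c) * X)
                                                           ≡⟨ eq₂ c W H G X Y ⟩
    suc c * c * G + Z                                      ∎))
  where
  open ≤-Reasoning
  Z : ℕ
  Z = suc c * (H + G) + 2 * (suc c * suc c) * W * X + 2 * c * W * X + 2 * c * W * Y
  eq₁ : ∀ c W H G X Y C →
    suc c * c * (H + 2 * W * C) + (suc c * (H + G) + 2 * (suc c * suc c) * W * X + 2 * c * W * X + 2 * c * W * Y)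
    ≡ suc c * (suc c * H + suc c * W * X + G) + (suc c * suc c * W + 2 * c * W) * X + 2 * c * W * (suc c * C + Y)
  eq₁ = solve-∀
  eq₂ : ∀ c W H G X Y →
    suc c * (suc c * G + H) + 2 * c * W * Y + 2 * suc c * W * X + 2 * c * W * (suc (suc c) * X)
    ≡ suc c * c * G + (suc c * (H + G) + 2 * (suc c * suc c) * W * X + 2 * c * W * X + 2 * c * W * Y)
  eq₂ = solve-∀

-- The sparse and dense cases and their combination.

sparse-bound : ∀ {n c′} .{{_ : NonZero n}} (R : List (Point n (suc (suc c′)))) →
  let c = suc c′; N = length R; W = n ^ c′ in
  c * N ≤ n * W → c * (N * N) + W * coveredCount R ≤ suc c * W * n * N
sparse-bound {n} {c′} R cN≤nW = *-cancelˡ-≤ 2 (begin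
  2 * (c * (N * N) + W * C)        ≡⟨ eq₁ c N W C ⟩
  2 * c * (N * N) + 2 * W * C      ≤⟨ eliminate-crossings c W (2 * c * (N * N)) (2 * suc c * W * n * N) (sum (lines r))
                                        (∑[ i < suc c ] ∑[ j < suc c ] crossings r i j) C
                                        (∑-off-diagonal c W _ _ (lines r) (crossings r) (crossings-diagonal r) off)
                                        (coveredCount+crossings≤ R) ⟩
  2 * suc c * W * n * N            ≡⟨ eq₂ c W n N ⟩
  2 * (suc c * W * n * N)          ∎)
  where
  open ≤-Reasoning
  c N W C : ℕ
  c = suc c′
  N = length R
  W = n ^ c′
  C = coveredCount R
  r : Point n (suc c) → ℕ
  r = multiplicity R
  off : ∀ {i j} → i ≢ j → suc c * W * (lines r i + lines r j) + 2 * c * (N * N)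
                        ≤ 2 * suc c * W * n * N + 2 * c * W * crossings r i j
  -- `crossings-≥` speaks of the total weight `∑ₚ r`, which is `length R` here.
  off {i} {j} i≢j = subst (λ M → c * M ≤ W * n →
      suc c * W * (lines r i + lines r j) + 2 * c * (M * M) ≤ 2 * suc c * W * n * M + 2 * c * W * crossings r i j)
    (∑ₚ-multiplicity R) (crossings-≥ r i≢j) (≤-trans cN≤nW (≤-reflexive (*-comm n W)))
  eq₁ : ∀ c N W C → 2 * (c * (N * N) + W * C) ≡ 2 * c * (N * N) + 2 * W * C
  eq₁ = solve-∀
  eq₂ : ∀ c W n N → 2 * suc c * W * n * N ≡ 2 * (suc c * W * n * N)
  eq₂ = solve-∀

-- From (D - N)(D - c N) ≤ 0 follows D² + c N² ≤ (c + 1) N D; multiplied by `n`, this puts the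
-- claimed bound above the trivial count `n * D`.
dense-bound : ∀ {n c} (R : List (Point n (suc c))) →
  let N = length R; D = n ^ c in
  N ≤ D → D ≤ c * N → coveredCount R * D + c * (N * N) * n ≤ suc c * N * (n * D)
dense-bound {n} {c} R N≤D D≤cN = begin
  coveredCount R * D + c * (N * N) * n   ≤⟨ +-monoˡ-≤ _ (*-monoˡ-≤ D (coveredCount≤n^k R)) ⟩
  n * D * D + c * (N * N) * n            ≡⟨ eq₁ n D (c * (N * N)) ⟩
  n * (D * D + c * (N * N))              ≤⟨ *-monoʳ-≤ n (square-below-chord c N D N≤D D≤cN) ⟩
  n * (suc c * (N * D))                  ≡⟨ eq₂ n c N D ⟩
  suc c * N * (n * D)                    ∎
  where
  open ≤-Reasoning
  N D : ℕ
  N = length R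
  D = n ^ c
  eq₁ : ∀ n D u → n * D * D + u * n ≡ n * (D * D + u)
  eq₁ = solve-∀
  eq₂ : ∀ n c N D → n * (suc c * (N * D)) ≡ suc c * N * (n * D)
  eq₂ = solve-∀

-- The bound is multiplied by `D`, which is n^(k-1). Dividing by n^(k-2) thus becomes multiplying by
-- `n`, and no negative exponent arises at k = 1.
rook-bound : ∀ {n} .{{_ : NonZero n}} c (R : List (Point n (suc c))) →
  let N = length R; D = n ^ c in
  N ≤ D → coveredCount R * D + c * (N * N) * n ≤ suc c * N * (n * D)
-- With a single direction there are no crossings to subtract: each rook accounts for at most `n`
-- covered points.
rook-bound {n} zero R _ = begin
  coveredCount R * 1 + 0              ≡⟨ trans (+-identityʳ _) (*-identityʳ _) ⟩
  coveredCount R                      ≤⟨ coveredCount≤∑lines R ⟩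
  lines r zero + 0                    ≡⟨ +-identityʳ _ ⟩
  lines r zero                        ≤⟨ lines-≤ r zero ⟩
  n * ∑ₚ r                            ≡⟨ cong (n *_) (∑ₚ-multiplicity R) ⟩
  n * length R                        ≡⟨ eq n (length R) ⟩
  1 * length R * (n * 1)              ∎
  where
  open ≤-Reasoning
  r : Point n 1 → ℕ
  r = multiplicity R
  eq : ∀ n N → n * N ≡ 1 * N * (n * 1)
  eq = solve-∀
rook-bound {n} (suc c′) R N≤D with ≤-total (n ^ suc c′) (suc c′ * length R)
... | inj₁ D≤cN = dense-bound {n} {suc c′} R N≤D D≤cN
... | inj₂ cN≤D = begin
  C * (n * W) + c * (N * N) * n      ≡⟨ eq₁ n W C (c * (N * N)) ⟩
  n * (c * (N * N) + W * C)          ≤⟨ *-monoʳ-≤ n (sparse-bound {n} {c′} R cN≤D) ⟩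
  n * (suc c * W * n * N)            ≡⟨ eq₂ n c W N ⟩
  suc c * N * (n * (n * W))          ∎
  where
  open ≤-Reasoning
  c N W C : ℕ
  c = suc c′
  N = length R
  W = n ^ c′
  C = coveredCount R
  eq₁ : ∀ n W C u → C * (n * W) + u * n ≡ n * (u + W * C)
  eq₁ = solve-∀
  eq₂ : ∀ n c W N → n * (suc c * W * n * N) ≡ suc c * N * (n * (n * W))
  eq₂ = solve-∀

theorem7 : (k : ℕ) → 1 ≤ k →
    ∃[ n₀ ] ((n : ℕ) → n₀ ≤ n → (N : ℕ) → N ≤ n ^ (k ∸ 1) →
    (rooks : List (Point n k)) → length rooks ≡ N → Unique rooks →
    coveredCount rooks * n ^ (k ∸ 1) + (k ∸ 1) * (N * N) * n ≤ k * N * n ^ k)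
-- The threshold 1 makes `n` nonzero, as cancelling `W * n * n` requires.
theorem7 (suc c) _ = 1 , λ { n 1≤n _ N≤D rooks refl _ → rook-bound {n} {{>-nonZero 1≤n}} c rooks N≤D }
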